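{- For every theory $\Sigma$ and every formula $A \Rightarrow B$: $\Sigma \vdash A \Rightarrow B$ if and only if $\Sigma \models A \Rightarrow B$.
   Context: $Y$ is a non-empty finite set of attributes and $\mathcal{T}_Y = \{y^i \mid y \in Y, i \in \mathbb{Z}\}$; $M + j = \{y^{i+j} \mid y^i \in M\}$. A formula is $A \Rightarrow B$ with $A,B$ finite subsets of $\mathcal{T}_Y$; $M \models A \Rightarrow B$ means that for every $i \in \mathbb{Z}$, $A+i \subseteq M$ implies $B+i \subseteq M$; $\Sigma \models A \Rightarrow B$ means $A \Rightarrow B$ is true in every $M \subseteq \mathcal{T}_Y$ in which all formulas of the theory $\Sigma$ are true. Deduction rules (for arbitrary finite $A,B,C,D \subseteq \mathcal{T}_Y$, $i \in \mathbb{Z}$): (Ax) infer $A \cup B \Rightarrow A$; (Cut) from $A \Rightarrow B$ and $B \cup C \Rightarrow D$ infer $A \cup C \Rightarrow D$; (Shf) from $A \Rightarrow B$ infer $A+i \Rightarrow B+i$. $\Sigma \vdash A \Rightarrow B$ means there is a finite sequence of formulas ending with $A \Rightarrow B$ in which each member is in $\Sigma$ or is the conclusion of one of these rules applied to earlier members. -}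

module Defs where

open import Data.Integer.Base using (ℤ; _+_)
open import Data.List.Base using (List; []; _++_; map; _∷ʳ_)
open import Data.List.Relation.Binary.BagAndSetEquality using (_∼[_]_; set)
open import Data.List.Relation.Unary.All using (All)
open import Data.List.Relation.Unary.Any using (Any)
open import Data.Product.Base using (_×_; _,_; ∃-syntax)
open import Level using (Level; suc)
open import Relation.Unary using (Pred; _∈_)

-- The pair (y , i) is the attribute y annotated by the time point i.
𝒯 : Set → Set
𝒯 Y = Y × ℤ

-- A finite subset of 𝒯 Y is a list, read up to mutual inclusion: order and
-- multiplicity are discarded by _≈_ on formulas below.
FinSubset : Set → Set
FinSubset Y = List (𝒯 Y)

infix 4 _⇒_

record Formula (Y : Set) : Set where
  constructor _⇒_
  field
    antecedent consequent : FinSubset Y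

-- A theory may be infinite, and need not be decidable.
Theory : Set → (ℓ : Level) → Set (suc ℓ)
Theory Y ℓ = Pred (Formula Y) ℓ

module _ {Y : Set} where

  infixl 7 _⊕_
  infixr 6 _∪_
  infix 4 _⊆_ _⊨ᴹ_ _⊨_ _⊢_ _≈_ _∈ᵗ_ _∈ˢ_

  _∪_ : FinSubset Y → FinSubset Y → FinSubset Y
  _∪_ = _++_

  _⊕_ : FinSubset Y → ℤ → FinSubset Y
  A ⊕ j = map (λ (y , i) → y , i + j) A

  _⊆_ : ∀ {ℓ} → FinSubset Y → Pred (𝒯 Y) ℓ → Set ℓ
  A ⊆ M = All (_∈ M) A

  _≈_ : Formula Y → Formula Y → Set
  (A ⇒ B) ≈ (C ⇒ D) = (A ∼[ set ] C) × (B ∼[ set ] D)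

  -- Membership of formulas in theories and in sequences, up to _≈_.
  _∈ᵗ_ : ∀ {ℓ} → Formula Y → Theory Y ℓ → Set ℓ
  φ ∈ᵗ Σ = ∃[ ψ ] ψ ∈ Σ × φ ≈ ψ

  _∈ˢ_ : Formula Y → List (Formula Y) → Set
  φ ∈ˢ φs = Any (φ ≈_) φs

  _⊨ᴹ_ : ∀ {ℓ} → Pred (𝒯 Y) ℓ → Formula Y → Set ℓ
  M ⊨ᴹ (A ⇒ B) = ∀ (i : ℤ) → A ⊕ i ⊆ M → B ⊕ i ⊆ M

  _⊨_ : ∀ {ℓ} → Theory Y ℓ → Formula Y → Set (suc ℓ)
  _⊨_ {ℓ} Σ φ =
    ∀ (M : Pred (𝒯 Y) ℓ) → (∀ ψ → ψ ∈ᵗ Σ → M ⊨ᴹ ψ) → M ⊨ᴹ φ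

  -- Step Σ φs φ: φ may be appended to a deduction whose members so far are φs.
  data Step {ℓ} (Σ : Theory Y ℓ) (φs : List (Formula Y)) (φ : Formula Y) : Set ℓ where
    hyp : φ ∈ᵗ Σ → Step Σ φs φ
    Ax  : ∀ A B → φ ≈ (A ∪ B ⇒ A) → Step Σ φs φ
    Cut : ∀ A B C D → (A ⇒ B) ∈ˢ φs → (B ∪ C ⇒ D) ∈ˢ φs →
          φ ≈ (A ∪ C ⇒ D) → Step Σ φs φ
    Shf : ∀ A B i → (A ⇒ B) ∈ˢ φs → φ ≈ (A ⊕ i ⇒ B ⊕ i) → Step Σ φs φ

  data IsDeduction {ℓ} (Σ : Theory Y ℓ) : List (Formula Y) → Set ℓ where
    empty  : IsDeduction Σ []
    append : ∀ {φs φ} → IsDeduction Σ φs → Step Σ φs φ → IsDeduction Σ (φs ∷ʳ φ)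

  _⊢_ : ∀ {ℓ} → Theory Y ℓ → Formula Y → Set ℓ
  Σ ⊢ φ = ∃[ φs ] IsDeduction Σ (φs ∷ʳ φ)

{-# OPTIONS --safe #-}

-- For completeness, the points t with Σ ⊢ A ⇒ {t} form a model of Σ: an
-- instance C + i ⇒ D + i of a formula in Σ is derivable by (Shf), and its
-- singletons accumulate to A ⇒ C + i by (Cut), whence A ⇒ D + i. This model
-- contains A, so if Σ ⊨ A ⇒ B it contains B, and Σ ⊢ A ⇒ B by accumulation.
module Submission where

open import Defs
open import Algebra.Bundles using (CommutativeMonoid)
open import Data.Fin.Base using (Fin)
open import Data.Integer.Base using (ℤ; 0ℤ; _+_)
open import Data.Integer.Properties using (+-assoc; +-identityʳ)
open import Data.List.Base using (List; []; _∷_; _++_; [_]; _∷ʳ_)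
open import Data.List.Membership.Propositional.Properties using (∈-++⁺ˡ; ∈-++⁺ʳ)
open import Data.List.Properties using (++-assoc; ++-identityʳ; map-++; map-∘; map-cong; map-id)
open import Data.List.Relation.Binary.BagAndSetEquality
  using (set; [_]-Equality; commutativeMonoid; ++-idempotent)
  renaming (map-cong to map-cong-∼)
open import Data.List.Relation.Binary.Subset.Propositional using () renaming (_⊆_ to _⊆ˡ_)
open import Data.List.Relation.Binary.Subset.Propositional.Properties using (∈-∷⁺ʳ)
open import Data.List.Relation.Unary.All as All using (All; []; _∷_)
open import Data.List.Relation.Unary.All.Properties as All using ()
open import Data.List.Relation.Unary.Any using (here)
open import Data.List.Relation.Unary.Any.Properties as Any using ()
open import Data.Nat.Base using (ℕ; suc)
open import Data.Product.Base using (_×_; _,_; proj₁; proj₂)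
open import Data.Sum.Base using ([_,_]′)
open import Function.Base using (id; _∘_)
open import Function.Bundles using (_⇔_; _↔_; mk⇔; Equivalence)
open import Level using (Level)
open import Relation.Binary.Bundles using (Setoid)
open import Relation.Binary.PropositionalEquality using (_≡_; refl; sym; trans; cong; subst; subst₂)
open import Relation.Unary using (Pred)

module _ {Y : Set} where

  private module ∼ = Setoid ([ set ]-Equality (𝒯 Y))
  private module ∪ = CommutativeMonoid (commutativeMonoid set (𝒯 Y))

  ≈-refl : {φ : Formula Y} → φ ≈ φ
  ≈-refl = ∼.refl , ∼.refl

  ⊕-⊕ : (A : FinSubset Y) (i j : ℤ) → A ⊕ i ⊕ j ≡ A ⊕ (i + j)
  ⊕-⊕ A i j = trans (sym (map-∘ A)) (map-cong (λ (y , k) → cong (y ,_) (+-assoc k i j)) A)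

  ⊕-0 : (A : FinSubset Y) → A ⊕ 0ℤ ≡ A
  ⊕-0 A = trans (map-cong (λ (y , k) → cong (y ,_) (+-identityʳ k)) A) (map-id A)

  ⊕-cong : {A B : FinSubset Y} (i : ℤ) → A ∼.≈ B → (A ⊕ i) ∼.≈ (B ⊕ i)
  ⊕-cong i A∼B = map-cong-∼ (λ _ → refl) A∼B

  module _ {ℓ} {M : Pred (𝒯 Y) ℓ} where

    ⊆-resp-∼ : {A B : FinSubset Y} → A ∼.≈ B → A ⊆ M → B ⊆ M
    ⊆-resp-∼ A∼B = All.anti-mono (Equivalence.from A∼B)

    ⊆-∪⁻ : (A B : FinSubset Y) (i : ℤ) → (A ∪ B) ⊕ i ⊆ M → (A ⊕ i ⊆ M) × (B ⊕ i ⊆ M)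
    ⊆-∪⁻ A B i p = All.++⁻ (A ⊕ i) (subst (_⊆ M) (map-++ _ A B) p)

    ⊆-∪⁺ : (A B : FinSubset Y) (i : ℤ) → A ⊕ i ⊆ M → B ⊕ i ⊆ M → (A ∪ B) ⊕ i ⊆ M
    ⊆-∪⁺ A B i p q = subst (_⊆ M) (sym (map-++ _ A B)) (All.++⁺ p q)

    ⊨ᴹ-resp-≈ : {φ ψ : Formula Y} → φ ≈ ψ → M ⊨ᴹ ψ → M ⊨ᴹ φ
    ⊨ᴹ-resp-≈ (A∼C , B∼D) M⊨ψ i =
      ⊆-resp-∼ (∼.sym (⊕-cong i B∼D)) ∘ M⊨ψ i ∘ ⊆-resp-∼ (⊕-cong i A∼C)

    ⊨ᴹ-∈ˢ : {φ : Formula Y} {φs : List (Formula Y)} → All (M ⊨ᴹ_) φs → φ ∈ˢ φs → M ⊨ᴹ φ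
    ⊨ᴹ-∈ˢ {φ} M⊨φs φ∈φs with All.lookupAny M⊨φs φ∈φs
    ... | M⊨ψ , φ≈ψ = ⊨ᴹ-resp-≈ {φ} φ≈ψ M⊨ψ

    -- Truth in `M` already quantifies over all shifts: the instance of the shifted formula at `j`
    -- is the instance of the original at `i + j`.
    ⊨ᴹ-⊕ : (A B : FinSubset Y) (i : ℤ) → M ⊨ᴹ (A ⇒ B) → M ⊨ᴹ (A ⊕ i ⇒ B ⊕ i)
    ⊨ᴹ-⊕ A B i M⊨ j p =
      subst (_⊆ M) (sym (⊕-⊕ B i j)) (M⊨ (i + j) (subst (_⊆ M) (⊕-⊕ A i j) p))

    module _ {ℓ′} {Σ : Theory Y ℓ′} (M⊨Σ : ∀ ψ → ψ ∈ᵗ Σ → M ⊨ᴹ ψ) where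

      step-sound : ∀ {φs φ} → All (M ⊨ᴹ_) φs → Step Σ φs φ → M ⊨ᴹ φ
      step-sound M⊨φs (hyp φ∈Σ) = M⊨Σ _ φ∈Σ
      step-sound {φ = φ} M⊨φs (Ax A B φ≈) =
        ⊨ᴹ-resp-≈ {φ} φ≈ λ i → proj₁ ∘ ⊆-∪⁻ A B i
      step-sound {φ = φ} M⊨φs (Cut A B C D p q φ≈) = ⊨ᴹ-resp-≈ {φ} φ≈ λ i A∪C →
        let a , c = ⊆-∪⁻ A C i A∪C
        in ⊨ᴹ-∈ˢ M⊨φs q i (⊆-∪⁺ B C i (⊨ᴹ-∈ˢ M⊨φs p i a) c)
      step-sound {φ = φ} M⊨φs (Shf A B i p φ≈) =
        ⊨ᴹ-resp-≈ {φ} φ≈ (⊨ᴹ-⊕ A B i (⊨ᴹ-∈ˢ M⊨φs p))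

      -- The induction carries truth of every member, not only of the last, since a rule may draw on
      -- any earlier formula.
      deduction-sound : ∀ {φs} → IsDeduction Σ φs → All (M ⊨ᴹ_) φs
      deduction-sound empty = []
      deduction-sound (append d s) =
        let M⊨φs = deduction-sound d in All.∷ʳ⁺ M⊨φs (step-sound M⊨φs s)

  sound : ∀ {ℓ} {Σ : Theory Y ℓ} {φ : Formula Y} → Σ ⊢ φ → Σ ⊨ φ
  sound (_ , d) M M⊨Σ = proj₂ (All.∷ʳ⁻ (deduction-sound M⊨Σ d))

  module _ {ℓ} {Σ : Theory Y ℓ} where

    step-weaken : ∀ {φs ψs φ} → (∀ {ψ} → ψ ∈ˢ φs → ψ ∈ˢ ψs) → Step Σ φs φ → Step Σ ψs φ
    step-weaken w (hyp φ∈Σ) = hyp φ∈Σ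
    step-weaken w (Ax A B φ≈) = Ax A B φ≈
    step-weaken w (Cut A B C D p q φ≈) = Cut A B C D (w p) (w q) φ≈
    step-weaken w (Shf A B i p φ≈) = Shf A B i (w p) φ≈

    -- Needed for (Cut), whose two premises come with separate deductions but must occur in a single
    -- sequence.
    deduction-++ : ∀ {φs ψs} → IsDeduction Σ φs → IsDeduction Σ ψs → IsDeduction Σ (φs ++ ψs)
    deduction-++ {φs} d empty = subst (IsDeduction Σ) (sym (++-identityʳ φs)) d
    deduction-++ {φs} d (append {ψs} {ψ} e s) =
      subst (IsDeduction Σ) (++-assoc φs ψs [ ψ ])
        (append (deduction-++ d e) (step-weaken (Any.++⁺ʳ φs) s))

    ∈ˢ-last : ∀ φs {φ : Formula Y} → φ ∈ˢ (φs ∷ʳ φ)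
    ∈ˢ-last φs {φ} = Any.++⁺ʳ φs (here (≈-refl {φ}))

    ⊢-hyp : ∀ {φ} → φ ∈ᵗ Σ → Σ ⊢ φ
    ⊢-hyp φ∈Σ = [] , append empty (hyp φ∈Σ)

    -- As sets, `A` and `B ∪ A` coincide, so this is an instance of (Ax) up to `_≈_`.
    ⊢-weaken : {A B : FinSubset Y} → B ⊆ˡ A → Σ ⊢ (A ⇒ B)
    ⊢-weaken {A} {B} B⊆A = [] , append empty (Ax B A (A∼B∪A , ∼.refl))
      where
      A∼B∪A : A ∼.≈ (B ∪ A)
      A∼B∪A = mk⇔ (∈-++⁺ʳ B) ([ B⊆A , id ]′ ∘ Any.++⁻ B)

    -- The antecedent `E` is free up to set equality, so that commutativity, idempotence and the
    -- unit law of `_∪_` are absorbed into the cut itself.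
    ⊢-cut : {A B C D E : FinSubset Y} → Σ ⊢ (A ⇒ B) → Σ ⊢ (B ∪ C ⇒ D) →
            E ∼.≈ (A ∪ C) → Σ ⊢ (E ⇒ D)
    ⊢-cut {A} {B} {C} {D} (φs , d) (ψs , e) E∼A∪C =
      _ , append (deduction-++ d e)
        (Cut A B C D (Any.++⁺ˡ (∈ˢ-last φs)) (Any.++⁺ʳ (φs ∷ʳ (A ⇒ B)) (∈ˢ-last ψs))
          (E∼A∪C , ∼.refl))

    ⊢-shift : {A B : FinSubset Y} (i : ℤ) → Σ ⊢ (A ⇒ B) → Σ ⊢ (A ⊕ i ⇒ B ⊕ i)
    ⊢-shift {A} {B} i (φs , d) =
      _ , append d (Shf A B i (∈ˢ-last φs) (≈-refl {A ⊕ i ⇒ B ⊕ i}))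

    ⊢-trans : {A B C : FinSubset Y} → Σ ⊢ (A ⇒ B) → Σ ⊢ (B ⇒ C) → Σ ⊢ (A ⇒ C)
    ⊢-trans {A} {B} {C} p q =
      -- A cut whose side set `C` is empty.
      ⊢-cut p (subst (λ X → Σ ⊢ (X ⇒ C)) (sym (++-identityʳ B)) q) (∼.sym (∪.identityʳ A))

    ⊢-singletons⁺ : {A B : FinSubset Y} → B ⊆ (λ t → Σ ⊢ (A ⇒ [ t ])) → Σ ⊢ (A ⇒ B)
    ⊢-singletons⁺ [] = ⊢-weaken λ ()
    ⊢-singletons⁺ {A} {t ∷ B} (p ∷ ps) =
      -- The inner cut turns `A ⇒ B` and `B ∪ [ t ] ⇒ t ∷ B` into `[ t ] ∪ A ⇒ t ∷ B`. Cutting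
      -- `A ⇒ [ t ]` against this leaves the antecedent `A ∪ A`, which is `A` as a set.
      ⊢-cut p
        (⊢-cut (⊢-singletons⁺ ps)
          (⊢-weaken (∈-∷⁺ʳ (∈-++⁺ʳ B (here refl)) ∈-++⁺ˡ))
          (∪.comm [ t ] A))
        (∼.sym (++-idempotent A))

    ⊢-singletons⁻ : {A B : FinSubset Y} → Σ ⊢ (A ⇒ B) → B ⊆ (λ t → Σ ⊢ (A ⇒ [ t ]))
    ⊢-singletons⁻ p = All.tabulate λ t∈B → ⊢-trans p (⊢-weaken (∈-∷⁺ʳ t∈B λ ()))

    complete : {A B : FinSubset Y} → Σ ⊨ (A ⇒ B) → Σ ⊢ (A ⇒ B)
    complete {A} {B} Σ⊨ =
      -- Truth of `A ⇒ B` in `M` is used only at shift `0ℤ`; its premise `A ⊆ M` comes from `A ⇒ A`.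
      ⊢-singletons⁺ (subst₂ (λ X Z → X ⊆ M → Z ⊆ M) (⊕-0 A) (⊕-0 B) (Σ⊨ M M⊨Σ 0ℤ)
        (⊢-singletons⁻ (⊢-weaken id)))
      where
      -- Derivability from `Σ` lives in `Set ℓ`, the level of the subsets over which `_⊨_`
      -- quantifies, so `Σ⊨` applies to this `M`.
      M : Pred (𝒯 Y) ℓ
      M t = Σ ⊢ (A ⇒ [ t ])

      M⊨Σ : ∀ ψ → ψ ∈ᵗ Σ → M ⊨ᴹ ψ
      M⊨Σ _ ψ∈Σ i C⊆M =
        ⊢-singletons⁻ (⊢-trans (⊢-singletons⁺ C⊆M) (⊢-shift i (⊢-hyp ψ∈Σ)))

theorem7 : ∀ {ℓ : Level} (Y : Set) (n : ℕ) → Y ↔ Fin (suc n) →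
    ∀ (Σ : Theory Y ℓ) (A B : FinSubset Y) →
    (Σ ⊢ (A ⇒ B)) ⇔ (Σ ⊨ (A ⇒ B))
theorem7 Y n Y↔Fin Σ A B = mk⇔ sound complete
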